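{- The following hold as $n\to\infty$: (1) $C_3(n,\mathrm{SP}_3)=\Omega\left(\left(\frac{\log n}{\log\log n}\right)^{1/8}\right)$; (2) $C_3(n,\mathrm{SP}^1_4)=\Omega(n^{1/8})$ and $C_3(n,\mathrm{SP}^2_4)=\Omega(n^{1/7})$; (3) for every $t\ge 5$, $C_3(n,\mathrm{SP}^1_t)=\Omega(n^{1/3})$ and $C_3(n,\mathrm{SP}^2_t)=\Omega(n^{1/3})$.
   Context: An $r$-graph is an $r$-uniform hypergraph; $K_n^{(r)}$ is the complete $r$-graph on $n$ vertices. For an $r$-graph $H$, an $(n,r,H)$-local coloring with $k$ colors is a family of $n$ edge-colorings $f_v:E(K_n^{(r)})\to[k]$, one for each vertex $v$ of $K_n^{(r)}$, such that for every copy $T$ of $H$ in $K_n^{(r)}$ there is a vertex $u\in V(T)$ for which $f_u$ is rainbow on $T$ (no two edges of $T$ get the same color under $f_u$). $C_r(n,H)$ is the minimum such $k$. $\mathrm{SP}_3$ is the $3$-graph with vertex set $\{a,b,c,d,e,f\}$ and edges $\{a,b,c\},\{b,c,d\},\{d,e,f\}$. For $t\ge1$, $\mathrm{SP}^1_t$ is the $3$-graph with edges $e_1,\dots,e_t$ on vertices $v_1,\dots,v_{\lceil (3t+3)/2\rceil}$, where $e_{2j-1}=\{v_{3j-2},v_{3j-1},v_{3j}\}$ and $e_{2j}=\{v_{3j},v_{3j+1},v_{3j+2}\}$ (so consecutive edges meet alternately in $1,2,1,2,\dots$ vertices; e.g. $\mathrm{SP}^1_4$ has edges $v_1v_2v_3,v_3v_4v_5,v_4v_5v_6,v_6v_7v_8$).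 $\mathrm{SP}^2_t$ is the $3$-graph with edges $e_1,\dots,e_t$ on vertices $v_1,\dots,v_{\lceil (3t+2)/2\rceil}$, where $e_{2j-1}=\{v_{3j-2},v_{3j-1},v_{3j}\}$ and $e_{2j}=\{v_{3j-1},v_{3j},v_{3j+1}\}$ (consecutive edges meet alternately in $2,1,2,1,\dots$ vertices; e.g. $\mathrm{SP}^2_4$ has edges $v_1v_2v_3,v_2v_3v_4,v_4v_5v_6,v_5v_6v_7$). -}

module Defs where

open import Data.Nat using (ℕ; zero; suc; _+_; _*_; _^_; _≤_; _<_; _/_)
open import Data.Nat.Logarithm using (⌊log₂_⌋)
open import Data.Fin using (Fin)
open import Data.Fin.Subset using (Subset; ⁅_⁆; _∪_; ∣_∣)
open import Data.Product using (Σ; ∃; ∃-syntax; _×_; _,_; proj₁)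
open import Relation.Binary.PropositionalEquality using (_≡_; _≢_)

-- A finite 3-graph H: vertices are 0 .. nV-1, edges are indexed by 0 .. nE-1,
-- edge i is the 3-set {a , b , c} where edge i = (a , b , c) (a, b, c distinct, < nV).
record Hyp3 : Set where
  field
    nV   : ℕ
    nE   : ℕ
    edge : ℕ → ℕ × ℕ × ℕ
open Hyp3 public

SP3 : Hyp3
SP3 = record { nV = 6 ; nE = 3 ; edge = e }
  where
  e : ℕ → ℕ × ℕ × ℕ
  e 0 = 0 , 1 , 2
  e 1 = 1 , 2 , 3
  e _ = 3 , 4 , 5

shift3 : ℕ × ℕ × ℕ → ℕ × ℕ × ℕ
shift3 (a , b , c) = 3 + a , 3 + b , 3 + c

sp1edge : ℕ → ℕ × ℕ × ℕ
sp1edge 0 = 0 , 1 , 2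
sp1edge 1 = 2 , 3 , 4
sp1edge (suc (suc i)) = shift3 (sp1edge i)

sp2edge : ℕ → ℕ × ℕ × ℕ
sp2edge 0 = 0 , 1 , 2
sp2edge 1 = 1 , 2 , 3
sp2edge (suc (suc i)) = shift3 (sp2edge i)

-- ⌈(3t+3)/2⌉ = ⌊(3t+4)/2⌋ vertices
SP1 : ℕ → Hyp3
SP1 t = record { nV = (3 * t + 4) / 2 ; nE = t ; edge = sp1edge }

-- ⌈(3t+2)/2⌉ = ⌊(3t+3)/2⌋ vertices
SP2 : ℕ → Hyp3
SP2 t = record { nV = (3 * t + 3) / 2 ; nE = t ; edge = sp2edge }

Edge : ℕ → Set
Edge n = Σ (Subset n) (λ s → ∣ s ∣ ≡ 3)

IsCopy : ∀ {n} → Hyp3 → (ℕ → Fin n) → Set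
IsCopy H φ = ∀ i j → i < nV H → j < nV H → φ i ≡ φ j → i ≡ j

image : ∀ {n} → (ℕ → Fin n) → ℕ × ℕ × ℕ → Subset n
image φ (a , b , c) = (⁅ φ a ⁆ ∪ ⁅ φ b ⁆) ∪ ⁅ φ c ⁆

Rainbow : ∀ {n k} → (H : Hyp3) → (Edge n → Fin k) → (ℕ → Fin n) → Set
Rainbow {n} H g φ =
  ∀ i j → i < nE H → j < nE H → i ≢ j →
  (e e′ : Edge n) → proj₁ e ≡ image φ (edge H i) → proj₁ e′ ≡ image φ (edge H j) →
  g e ≢ g e′

LocalColoring : ℕ → Hyp3 → ℕ → Set
LocalColoring n H k =
  Σ (Fin n → Edge n → Fin k) λ f →
    ∀ (φ : ℕ → Fin n) → IsCopy H φ →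
    ∃[ i ] (i < nV H × Rainbow H (f (φ i)) φ)

-- C_3(n,H) = Ω(n^(1/b)) :  ∃ K N. ∀ n ≥ N, every local colouring with k colours has n ≤ K * k^b
-- (equivalently C_3(n,H)^b ≥ n / K, since C_3(n,H) is the least such k)
OmegaRoot : Hyp3 → ℕ → Set
OmegaRoot H b =
  ∃[ K ] ∃[ N ] ∀ n → N ≤ n → ∀ k → LocalColoring n H k → n ≤ K * k ^ b

-- C_3(n,H) = Ω((log n / log log n)^(1/8)) , with logs rendered as floor log₂
OmegaLogLog8 : Hyp3 → Set
OmegaLogLog8 H =
  ∃[ K ] ∃[ N ] ∀ n → N ≤ n → ∀ k → LocalColoring n H k →
    ⌊log₂ n ⌋ ≤ K * k ^ 8 * ⌊log₂ ⌊log₂ n ⌋ ⌋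

{-# OPTIONS --safe #-}
module Submission where

-- In every case a copy is built in which each vertex u sees two edges of one colour under f_u.
-- Write {p} z for the edge on a pair p and a point z.
--
-- SP₃ is a p b q with edges {p} a, {p} b, {q} b.  Fix k² + 1 pairs.  Two points a, b look the
-- same to every vertex of every pair, and two pairs p, q then get the same colours from a and
-- b on {p} b, {q} b.  This needs only n ≥ k^O(k⁴), so log n = O(k⁵).
--
-- SP²₄ is a p b q c.  A pair p colours the point z by what its two vertices see on {p} z.
-- Among 4k² points, averaging gives one triple a, b, c monochromatic for more than k³ of
-- O(k⁷) pairs, two of which look the same to a, b, c on {p} b.  For SP¹₄, which is
-- p x r y q with edges {p} x, {r} x, {r} y, {q} y, the roles of pairs and points are exchanged.
--
-- For t ≥ 5 the path contains two vertex-disjoint blocks: two edges sharing a pair, and two edges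
-- sharing one vertex.  The first block is chosen so that n/4k of the other vertices agree on it;
-- the rest of the path is taken from those.  There the four vertices of the first block colour
-- triples with k⁴ colours, and a colour class on O(k²) points without two triples
-- meeting in exactly one point has only O(k²) triples, which is too few.

open import Defs
open import Data.Bool using (Bool)
open import Data.Empty using (⊥)
open import Data.Fin as Fin using (Fin; zero; suc; inject≤; toℕ; funToFin; finToFun)
open import Data.Fin.Patterns using (0F; 1F; 2F)
open import Data.Fin.Properties as Finₚ using (pigeonhole; any?; inject≤-injective; +↔⊎; *↔×; 2↔Bool; finToFun-funToFin; toℕ-injective; toℕ<n)
open import Data.Fin.Subset using (Subset; ⁅_⁆; _∪_; ∣_∣; _∉_; inside; outside)
open import Data.Fin.Subset.Properties using (∪-comm; ∪-assoc; ∪-identityʳ; x∈⁅y⁆⇒x≡y; x∈p∪q⁻; ∣⁅x⁆∣≡1)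
open import Data.List using (List; []; _∷_; _++_; length; map; filter; tabulate; allFin; lookup)
open import Data.List.Properties using (length-tabulate; length-map)
open import Data.List.Relation.Unary.All as All using (All; []; _∷_)
import Data.List.Relation.Unary.All.Properties as Allₚ
open import Data.List.Membership.Propositional.Properties using (∈-lookup)
open import Data.List.Relation.Unary.AllPairs using ([]; _∷_)
import Data.List.Relation.Unary.AllPairs.Properties as AllPairsₚ
open import Data.List.Relation.Binary.Permutation.Propositional using (↭⇒↭ₛ)
open import Data.List.Relation.Binary.Permutation.Propositional.Properties using (shifts)
open import Data.List.Relation.Binary.Permutation.Setoid.Properties using (Unique-resp-↭)
open import Data.List.Relation.Unary.Unique.Propositional using (Unique)
import Data.List.Relation.Unary.Unique.Propositional.Properties as Uniqueₚ
open import Data.Nat using (ℕ; zero; suc; _+_; _*_; _^_; _≤_; _<_; z≤n; s≤s; s≤s⁻¹; NonZero; >-nonZero⁻¹)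
open import Data.Nat.DivMod using (/-monoˡ-≤)
open import Data.Nat.Logarithm using (⌊log₂_⌋; ⌊log₂⌋-mono-≤; ⌊log₂[2^n]⌋≡n)
open import Data.Nat.Properties as ℕₚ using (≤-trans; module ≤-Reasoning)
open import Data.Nat.Tactic.RingSolver using (solve-∀)
open import Data.Product using (∃; ∃₂; ∃-syntax; _×_; _,_; proj₁; proj₂)
open import Data.Product.Function.NonDependent.Propositional using (_×-↔_)
open import Data.Product.Properties using (,-injective)
open import Data.Sum using (_⊎_; inj₁; inj₂)
open import Data.Sum.Function.Propositional using (_⊎-↔_)
open import Data.Sum.Properties using (inj₁-injective; inj₂-injective)
open import Data.Vec using (_∷_; here; there)
open import Function using (_∘_; id; _↔_; Inverse; Injection; Injective)
open import Function.Properties.Inverse using (↔-sym; ↔-trans; ↔-refl; ↔⇒↣)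
open import Relation.Binary.Definitions using (DecidableEquality; tri<; tri≈; tri>)
open import Relation.Binary.PropositionalEquality using (_≡_; _≢_; refl; sym; trans; cong; subst; setoid)
open import Relation.Nullary using (¬_; Dec; yes; no; does; contradiction; ¬?; _×-dec_)
open import Relation.Nullary.Decidable using (True; False; toWitness; toWitnessFalse; via-injection)
open import Relation.Unary using (Decidable)

private variable
  A B C : Set
  m n k q : ℕ

-- Pigeonhole principles

_×ᶠ_ : A ↔ Fin m → B ↔ Fin n → (A × B) ↔ Fin (m * n)
a ×ᶠ b = ↔-trans (a ×-↔ b) (↔-sym *↔×)

_⊎ᶠ_ : A ↔ Fin m → B ↔ Fin n → (A ⊎ B) ↔ Fin (m + n)
a ⊎ᶠ b = ↔-trans (a ⊎-↔ b) (↔-sym +↔⊎)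

infixr 7 _×ᶠ_
infixr 6 _⊎ᶠ_

to-injective : (e : A ↔ B) → Injective _≡_ _≡_ (Inverse.to e)
to-injective e = Injection.injective (↔⇒↣ e)

from-injective : (e : A ↔ B) → Injective _≡_ _≡_ (Inverse.from e)
from-injective e = to-injective (↔-sym e)

≡-decᶠ : A ↔ Fin m → DecidableEquality A
≡-decᶠ e = via-injection (↔⇒↣ e) Finₚ._≟_

collision : A ↔ Fin m → B ↔ Fin n → n < m → (h : A → B) →
            ∃₂ λ x y → x ≢ y × h x ≡ h y
collision a b n<m h
  with i , j , i<j , eq ← pigeonhole n<m (Inverse.to b ∘ h ∘ Inverse.from a)
  = Inverse.from a i , Inverse.from a j ,
    (λ eq′ → Finₚ.<⇒≢ i<j (from-injective a eq′)) , to-injective b eq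

-- Functions into `Fin k` on an `m`-element type are coded by numbers below `k ^ m`. Agreement is
-- recovered pointwise by decoding, so no extensionality enters.
function-collision : ∀ {N} → A ↔ Fin m → k ^ m < N → (g : Fin N → A → Fin k) →
                     ∃₂ λ x y → x ≢ y × (∀ w → g x w ≡ g y w)
function-collision {A = A} {m} {k} {N} e lt g
  with x , y , x<y , eq ← pigeonhole lt (λ z → funToFin (g z ∘ Inverse.from e))
  = x , y , Finₚ.<⇒≢ x<y , agree
  where
  decode : ∀ z w → finToFun (funToFin (g z ∘ Inverse.from e)) (Inverse.to e w) ≡ g z w
  decode z w = trans (finToFun-funToFin (g z ∘ Inverse.from e) (Inverse.to e w))
                     (cong (g z) (Inverse.strictlyInverseʳ e w))
  agree : ∀ w → g x w ≡ g y w
  agree w = trans (sym (decode x w))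
              (trans (cong (λ c → finToFun c (Inverse.to e w)) eq) (decode y w))

lookup-injective : {xs : List A} → Unique xs → ∀ i j → lookup xs i ≡ lookup xs j → i ≡ j
lookup-injective (_ ∷ _)   zero    zero    _  = refl
lookup-injective {xs = _ ∷ xs} (x∉ ∷ _) zero (suc j) eq =
  contradiction eq (All.lookup x∉ (∈-lookup j))
lookup-injective {xs = _ ∷ xs} (x∉ ∷ _) (suc i) zero eq =
  contradiction (sym eq) (All.lookup x∉ (∈-lookup i))
lookup-injective (_ ∷ u)   (suc i) (suc j) eq = cong suc (lookup-injective u i j eq)

unique-length-≤ : {P : A → Set} {xs : List A} → B ↔ Fin q → (h : A → B) →
                  (∀ {x y} → P x → P y → h x ≡ h y → x ≡ y) →
                  Unique xs → All P xs → length xs ≤ q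
unique-length-≤ {xs = xs} b h inj u ps = ℕₚ.≮⇒≥ λ q<len →
  let i , j , i≢j , eq = collision ↔-refl b q<len (h ∘ lookup xs)
  in i≢j (lookup-injective u i j
       (inj (All.lookup ps (∈-lookup i)) (All.lookup ps (∈-lookup j)) eq))

unique-map⁺ : {P : A → Set} (h : A → B) → (∀ {x y} → P x → P y → h x ≡ h y → x ≡ y) →
              {xs : List A} → Unique xs → All P xs → Unique (map h xs)
unique-map⁺ h inj []       []       = []
unique-map⁺ h inj (x∉ ∷ u) (p ∷ ps) =
  Allₚ.map⁺ (All.zipWith (λ (x≢y , py) → x≢y ∘ inj p py) (x∉ , ps)) ∷ unique-map⁺ h inj u ps

length-filter-¬ : {P : A → Set} (P? : Decidable P) → ∀ xs →
                  length (filter P? xs) + length (filter (¬? ∘ P?) xs) ≡ length xs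
length-filter-¬ P? []       = refl
length-filter-¬ P? (x ∷ xs) with P? x
... | yes _ = cong suc (length-filter-¬ P? xs)
... | no  _ = trans (ℕₚ.+-suc _ _) (cong suc (length-filter-¬ P? xs))

-- Induction on the number of colours: either the class of the top colour `q` has more than `s`
-- members, or deleting it costs at most `s` and leaves more than `q * s` elements with colours
-- below `q`.
fibre<ℕ : ∀ {P : A → Set} q s (h : A → ℕ) {xs} → Unique xs → All (λ x → h x < q × P x) xs →
          q * s < length xs →
          ∃₂ λ y ys → Unique ys × All (λ x → h x ≡ y × P x) ys × s < length ys
fibre<ℕ zero    s h {_ ∷ _} u ((() , _) ∷ _) lt
fibre<ℕ {P = P} (suc q) s h {xs} u ps lt with s ℕₚ.<? length (filter (λ x → h x ℕₚ.≟ q) xs)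
... | yes s<len = q , filter (λ x → h x ℕₚ.≟ q) xs , Uniqueₚ.filter⁺ _ u ,
                  All.zipWith (λ (eq , _ , p) → eq , p)
                    (Allₚ.all-filter _ xs , Allₚ.filter⁺ _ ps) ,
                  s<len
... | no  s≮len = fibre<ℕ q s h (Uniqueₚ.filter⁺ _ u)
                  (All.zipWith (λ (≢q , h<1+q , p) → ℕₚ.≤∧≢⇒< (s≤s⁻¹ h<1+q) ≢q , p)
                     (Allₚ.all-filter (λ x → ¬? (h x ℕₚ.≟ q)) xs , Allₚ.filter⁺ _ ps))
                  (ℕₚ.+-cancelˡ-< s _ _ (begin-strict
                    s + q * s         <⟨ lt ⟩
                    length xs         ≡⟨ length-filter-¬ (λ x → h x ℕₚ.≟ q) xs ⟨
                    length (filter (λ x → h x ℕₚ.≟ q) xs) + _ ≤⟨ ℕₚ.+-monoˡ-≤ _ (ℕₚ.≮⇒≥ s≮len) ⟩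
                    s + _             ∎))
  where open ≤-Reasoning

fibre : {P : A → Set} → B ↔ Fin q → ∀ s (h : A → B) {xs} → Unique xs → All P xs →
        q * s < length xs →
        ∃₂ λ y ys → Unique ys × All (λ x → h x ≡ y × P x) ys × s < length ys
fibre b s h u ps lt
  with fibre<ℕ _ s (toℕ ∘ Inverse.to b ∘ h) u (All.map (toℕ<n _ ,_) ps) lt
... | y , [] , _ , _ , ()
... | y , ys@(z ∷ _) , uys , pys@((eq , _) ∷ _) , s<len =
  h z , ys , uys ,
  All.map (λ (eq′ , p) → to-injective b (toℕ-injective (trans eq′ (sym eq))) , p) pys , s<len

enumerate : A ↔ Fin m → List A
enumerate e = tabulate (Inverse.from e)

-- Two rows of a table sharing a monochromatic triple

module SharedTriple
  {C₁ C₂ : Set} {c₁ c₂ M N : ℕ} (e₁ : C₁ ↔ Fin c₁) (e₂ : C₂ ↔ Fin c₂)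
  (κ : Fin M → Fin N → C₁) (ρ : Fin N → Fin N → Fin N → Fin M → C₂) where

  Earlier : Fin M → Fin N → Set
  Earlier p x = ∃ λ a → a Fin.< x × κ p a ≡ κ p x

  Earlier₂ : Fin M → Fin N → Set
  Earlier₂ p x = ∃ λ a → ∃ λ b → (a Fin.< b × b Fin.< x) × κ p a ≡ κ p x × κ p b ≡ κ p x

  _≟₁_ : DecidableEquality C₁
  _≟₁_ = ≡-decᶠ e₁

  earlier? : ∀ p x → Dec (Earlier p x)
  earlier? p x = any? λ a → (a Finₚ.<? x) ×-dec (κ p a ≟₁ κ p x)

  earlier₂? : ∀ p x → Dec (Earlier₂ p x)
  earlier₂? p x = any? λ a → any? λ b → ((a Finₚ.<? b) ×-dec (b Finₚ.<? x))
                                 ×-dec ((κ p a ≟₁ κ p x) ×-dec (κ p b ≟₁ κ p x))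

  -- Within a row p, at most two positions of each κ-colour lack two earlier ones,
  -- and the Boolean tells them apart.
  label : Fin M × Fin N → (Fin M × C₁ × Bool) ⊎ (Fin N × Fin N × Fin N × C₂)
  label (p , x) with earlier₂? p x
  ... | yes (a , b , _) = inj₂ (a , b , x , ρ a b x p)
  ... | no  _           = inj₁ (p , κ p x , does (earlier? p x))

  Result : Set
  Result = ∃₂ λ p q → p ≢ q × ∃ λ a → ∃ λ b → ∃ λ c →
           (a ≢ b × a ≢ c × b ≢ c) ×
           (κ p a ≡ κ p b × κ p b ≡ κ p c) × (κ q a ≡ κ q b × κ q b ≡ κ q c) ×
           ρ a b c p ≡ ρ a b c q

  -- The flag at `y` is true because `x` is earlier with the same colour, hence so is the flag at
  -- `x`. Some `w` then precedes `x`, and `w`, `x` are the two earlier positions for `y`.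
  first-two : ∀ p x y → x Fin.< y → κ p x ≡ κ p y →
              does (earlier? p x) ≡ does (earlier? p y) → Earlier₂ p y
  first-two p x y x<y eq same with earlier? p x | earlier? p y
  ... | yes (w , w<x , e) | _       = w , x , (w<x , x<y) , trans e eq , eq
  ... | no _              | no none = contradiction (x , x<y , eq) none
  first-two p x y x<y eq () | no _ | yes _

  inj₂-quad : {D : Set} {a a′ b b′ x x′ : Fin N} {r r′ : C₂} →
              inj₂ {A = D} (a , b , x , r) ≡ inj₂ (a′ , b′ , x′ , r′) →
              a ≡ a′ × b ≡ b′ × x ≡ x′ × r ≡ r′
  inj₂-quad refl = refl , refl , refl , refl

  inj₁-triple : {D : Set} {p p′ : Fin M} {c c′ : C₁} {v v′ : Bool} →
                inj₁ {B = D} (p , c , v) ≡ inj₁ (p′ , c′ , v′) → p ≡ p′ × c ≡ c′ × v ≡ v′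
  inj₁-triple refl = refl , refl , refl

  resolve : ∀ s t → s ≢ t → label s ≡ label t → Result
  resolve (p , x) (q , y) s≢t eq with earlier₂? p x | earlier₂? q y
  resolve (p , x) (q , y) s≢t eq
    | yes (a , b , (a<b , b<x) , ea , eb) | yes (_ , _ , _ , ea′ , eb′)
    with refl , refl , refl , same ← inj₂-quad eq
    -- Equal labels fix the column `x` and the two earlier columns, so distinct cells lie in
    -- distinct rows.
    = p , q , (λ p≡q → s≢t (cong (_, x) p≡q)) , a , b , x ,
      (Finₚ.<⇒≢ a<b , Finₚ.<⇒≢ (Finₚ.<-trans a<b b<x) , Finₚ.<⇒≢ b<x) ,
      (trans ea (sym eb) , eb) , (trans ea′ (sym eb′) , eb′) , same
  resolve (p , x) (q , y) s≢t () | yes _ | no _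
  resolve (p , x) (q , y) s≢t () | no _ | yes _
  resolve (p , x) (q , y) s≢t eq | no ¬px | no ¬qy
    with refl , same-κ , same-flag ← inj₁-triple eq | Finₚ.<-cmp x y
  ... | tri< x<y _ _ = contradiction (first-two p x y x<y same-κ same-flag) ¬qy
  ... | tri≈ _ x≡y _ = contradiction (cong (p ,_) x≡y) s≢t
  ... | tri> _ _ y<x = contradiction (first-two p y x y<x (sym same-κ) (sym same-flag)) ¬px

  -- The left side counts labels: two flags for each row and colour, plus one quadruple for each
  -- triple of columns and value of `ρ`. The right side counts cells.
  shared-triple : M * (c₁ * 2) + N * (N * (N * c₂)) < M * N → Result
  shared-triple lt =
    let s , t , s≢t , eq = collision (↔-refl ×ᶠ ↔-refl)
          ((↔-refl ×ᶠ e₁ ×ᶠ ↔-sym 2↔Bool) ⊎ᶠ (↔-refl ×ᶠ ↔-refl ×ᶠ ↔-refl ×ᶠ e₂)) lt label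
    in resolve s t s≢t eq

-- Two positions on which many colourings agree

module _ {N k : ℕ} .{{_ : NonZero k}} (g : Fin N → Fin (2 * k) → Fin k) where

  private
    Repeat : Fin N × Fin (2 * k) → Set
    Repeat (u , i) = ∃ λ j → j Fin.< i × g u j ≡ g u i

    repeat? : Decidable Repeat
    repeat? (u , i) = any? λ j → (j Finₚ.<? i) ×-dec (g u j Finₚ.≟ g u i)

    -- Of two positions with one colour under `u`, the later is a repeat. So each `u` has at most
    -- one non-repeating position per colour, whence the bound `N * k` in `few`.
    no-repeat-injective : ∀ {s t} → ¬ Repeat s → ¬ Repeat t →
      (proj₁ s , g (proj₁ s) (proj₂ s)) ≡ (proj₁ t , g (proj₁ t) (proj₂ t)) → s ≡ t
    no-repeat-injective {u , i} {u′ , j} ¬s ¬t eq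
      with refl , same ← ,-injective eq | Finₚ.<-cmp i j
    ... | tri< i<j _ _ = contradiction (i , i<j , same) ¬t
    ... | tri≈ _ i≡j _ = cong (u ,_) i≡j
    ... | tri> _ _ j<i = contradiction (j , j<i , sym same) ¬s

    repeated : Fin N × Fin (2 * k) → Fin (2 * k) × Fin (2 * k)
    repeated (u , i) with repeat? (u , i)
    ... | yes (j , _) = i , j
    -- A default value: only repeating cells are passed to `fibre`.
    ... | no  _       = i , i

    Repeats : Fin (2 * k) × Fin (2 * k) → Fin N × Fin (2 * k) → Set
    Repeats (i , j) (u , i′) = i′ ≡ i × j Fin.< i × g u j ≡ g u i

    repeated-correct : ∀ t → Repeat t → Repeats (repeated t) t
    repeated-correct (u , i) r with repeat? (u , i)
    ... | yes (j , j<i , eq) = refl , j<i , eq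
    ... | no  ¬r             = contradiction r ¬r

  -- Each u repeats a colour at k or more of the 2k positions, so one of the
  -- 4k² pairs of positions receives the same colour from N/4k of the u.
  popular-pair : ∀ s → 4 * k * s < N →
    ∃₂ λ i j → i ≢ j × ∃ λ us → Unique us × s < length us × All (λ u → g u i ≡ g u j) us
  popular-pair s lt = conclude (fibre (↔-refl ×ᶠ ↔-refl) s repeated
      (Uniqueₚ.filter⁺ repeat? all-unique) (Allₚ.all-filter repeat? all) enough)
    where
    all : List (Fin N × Fin (2 * k))
    all = enumerate (↔-refl ×ᶠ ↔-refl)

    all-unique : Unique all
    all-unique = Uniqueₚ.tabulate⁺ (from-injective (↔-refl ×ᶠ ↔-refl))

    few : length (filter (¬? ∘ repeat?) all) ≤ N * k
    few = unique-length-≤ (↔-refl ×ᶠ ↔-refl) (λ (u , i) → u , g u i) no-repeat-injective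
            (Uniqueₚ.filter⁺ _ all-unique) (Allₚ.all-filter (¬? ∘ repeat?) all)

    regroup : ∀ k s → (2 * k) * (2 * k) * s ≡ (4 * k * s) * k
    regroup = solve-∀

    double : ∀ N k → N * k + N * k ≡ N * (2 * k)
    double = solve-∀

    open ≤-Reasoning

    -- At least `N * k` of the `N * (2 * k)` cells repeat, and `4 * k * s < N` makes this more than
    -- `s` for each of the `(2 * k) * (2 * k)` values of `repeated`.
    enough : (2 * k) * (2 * k) * s < length (filter repeat? all)
    enough = ℕₚ.+-cancelʳ-< (N * k) _ _ (begin-strict
      (2 * k) * (2 * k) * s + N * k ≡⟨ cong (_+ N * k) (regroup k s) ⟩
      (4 * k * s) * k + N * k       <⟨ ℕₚ.+-monoˡ-< (N * k) (ℕₚ.*-monoˡ-< k lt) ⟩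
      N * k + N * k                 ≡⟨ double N k ⟩
      N * (2 * k)                   ≡⟨ length-tabulate (Inverse.from (↔-refl {A = Fin N} ×ᶠ ↔-refl {A = Fin (2 * k)})) ⟨
      length all                    ≡⟨ length-filter-¬ repeat? all ⟨
      length (filter repeat? all) + length (filter (¬? ∘ repeat?) all) ≤⟨ ℕₚ.+-monoʳ-≤ _ few ⟩
      length (filter repeat? all) + N * k ∎)

    conclude : (∃₂ λ y ys → Unique ys × All (λ t → repeated t ≡ y × Repeat t) ys × s < length ys) →
      ∃₂ λ i j → i ≢ j × ∃ λ us → Unique us × s < length us × All (λ u → g u i ≡ g u j) us
    conclude ((i , j) , ys , uys , pys , s<len) = i , j , i≢j s<len rs , map proj₁ ys ,
        unique-map⁺ proj₁ (λ { (refl , _) (refl , _) refl → refl }) uys rs ,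
        subst (s <_) (sym (length-map proj₁ ys)) s<len ,
        Allₚ.map⁺ (All.map (λ (_ , _ , eq) → sym eq) rs)
      where
      rs : All (Repeats (i , j)) ys
      rs = All.map (λ {t} (eq , r) → subst (λ y → Repeats y t) eq (repeated-correct t r)) pys
      i≢j : ∀ {ys} → s < length ys → All (Repeats (i , j)) ys → i ≢ j
      i≢j _ ((_ , j<i , _) ∷ _) i≡j = Finₚ.<⇒≢ j<i (sym i≡j)

-- Two triples of one colour meeting in exactly one point

module _ {m c : ℕ} (e : C ↔ Fin c) (G : (x y z : Fin 3 × Fin m) → C)
         (rotate : ∀ x y z → G x y z ≡ G y z x) where

  private
    -- Only triples with one vertex in each of three disjoint copies of `Fin m` are considered, so
    -- vertices in different parts are distinct at once.
    g : (a b c : Fin m) → C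
    g a b c = G (0F , a) (1F , b) (2F , c)

    _≟ᶜ_ : DecidableEquality C
    _≟ᶜ_ = ≡-decᶠ e

    Along₃ Along₂ : (a b c : Fin m) → Set
    Along₃ a b c = ∃ λ c′ → c′ ≢ c × g a b c′ ≡ g a b c
    Along₂ a b c = ∃ λ b′ → b′ ≢ b × g a b′ c ≡ g a b c

    along₃? : ∀ a b c → Dec (Along₃ a b c)
    along₃? a b c = any? λ c′ → ¬? (c′ Finₚ.≟ c) ×-dec (g a b c′ ≟ᶜ g a b c)

    along₂? : ∀ a b c → Dec (Along₂ a b c)
    along₂? a b c = any? λ b′ → ¬? (b′ Finₚ.≟ b) ×-dec (g a b′ c ≟ᶜ g a b c)

    -- A colour class without two triples meeting in one point is a disjoint union of
    -- axis-parallel lines; the label is injective on it.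
    label : Fin m × Fin m × Fin m → Fin 3 × Fin m × C
    label (a , b , c) with along₃? a b c | along₂? a b c
    ... | yes _ | _     = 0F , c , g a b c
    ... | no  _ | yes _ = 1F , b , g a b c
    ... | no  _ | no  _ = 2F , a , g a b c

    Result : Set
    Result = ∃ λ v → ∃₂ λ w₁ w₂ → ∃₂ λ w₃ w₄ →
             Unique (w₁ ∷ w₂ ∷ v ∷ w₃ ∷ w₄ ∷ []) × G w₁ w₂ v ≡ G v w₃ w₄

    spread : ∀ {i j l : Fin 3} {a b b′ c c′ : Fin m} → i ≢ j → i ≢ l → j ≢ l → b ≢ b′ → c ≢ c′ →
             Unique ((j , b) ∷ (l , c) ∷ (i , a) ∷ (j , b′) ∷ (l , c′) ∷ [])
    spread i≢j i≢l j≢l b≢b′ c≢c′ =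
      (j≢l ∘ cong proj₁ ∷ i≢j ∘ sym ∘ cong proj₁ ∷ b≢b′ ∘ cong proj₂ ∷ j≢l ∘ cong proj₁ ∷ [])
      ∷ (i≢l ∘ sym ∘ cong proj₁ ∷ j≢l ∘ sym ∘ cong proj₁ ∷ c≢c′ ∘ cong proj₂ ∷ [])
      ∷ (i≢j ∘ cong proj₁ ∷ i≢l ∘ cong proj₁ ∷ []) ∷ (j≢l ∘ cong proj₁ ∷ []) ∷ [] ∷ []

    -- `Result` wants the common point last in one triple and first in the other; rotation brings it
    -- there, whichever coordinate is shared.
    meet₁ : ∀ {a b b′ c c′} → b ≢ b′ → c ≢ c′ → g a b c ≡ g a b′ c′ → Result
    meet₁ b≢b′ c≢c′ eq = _ , _ , _ , _ , _ , spread (λ ()) (λ ()) (λ ()) b≢b′ c≢c′ ,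
      trans (sym (rotate _ _ _)) eq

    meet₂ : ∀ {a a′ b c c′} → a ≢ a′ → c ≢ c′ → g a b c ≡ g a′ b c′ → Result
    meet₂ a≢a′ c≢c′ eq = _ , _ , _ , _ , _ , spread (λ ()) (λ ()) (λ ()) c≢c′ a≢a′ ,
      trans (rotate _ _ _) (trans eq (rotate _ _ _))

    meet₃ : ∀ {a a′ b b′ c} → a ≢ a′ → b ≢ b′ → g a b c ≡ g a′ b′ c → Result
    meet₃ a≢a′ b≢b′ eq = _ , _ , _ , _ , _ , spread (λ ()) (λ ()) (λ ()) a≢a′ b≢b′ ,
      trans eq (trans (rotate _ _ _) (rotate _ _ _))

    triple-injective : ∀ {i i′ : Fin 3} {a a′ : Fin m} {c c′ : C} →
                       (i , a , c) ≡ (i′ , a′ , c′) → i ≡ i′ × a ≡ a′ × c ≡ c′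
    triple-injective refl = refl , refl , refl

    -- Flag `0F`: the triples share `c`, and `(a , b , d)` has their colour. If `a` and `b` both
    -- differ from `a′` and `b′`, the triples meet only in `c`; if exactly one agrees, replacing `c`
    -- by `d` in the first triple leaves only that point in common. Flag `1F` is the same with `b`
    -- in place of `c`. Flag `2F`: agreement in just one further coordinate would be a line excluded
    -- by `¬₃` or `¬₂`.
    resolve : ∀ s t → s ≢ t → label s ≡ label t → Result
    resolve (a , b , c) (a′ , b′ , c′) s≢t eq
      with along₃? a b c | along₂? a b c | along₃? a′ b′ c′ | along₂? a′ b′ c′
    resolve (a , b , c) (a′ , b′ , c′) s≢t eq | yes (d , d≢c , eq₁) | _ | yes _ | _
      with _ , refl , same ← triple-injective eq | a Finₚ.≟ a′ | b Finₚ.≟ b′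
    ... | yes refl | yes refl = contradiction refl s≢t
    ... | yes refl | no b≢b′  = meet₁ b≢b′ d≢c (trans eq₁ same)
    ... | no a≢a′  | yes refl = meet₂ a≢a′ d≢c (trans eq₁ same)
    ... | no a≢a′  | no b≢b′  = meet₃ a≢a′ b≢b′ same
    resolve (a , b , c) (a′ , b′ , c′) s≢t eq | no _ | yes (d , d≢b , eq₁) | no _ | yes _
      with _ , refl , same ← triple-injective eq | a Finₚ.≟ a′ | c Finₚ.≟ c′
    ... | yes refl | yes refl = contradiction refl s≢t
    ... | yes refl | no c≢c′  = meet₁ d≢b c≢c′ (trans eq₁ same)
    ... | no a≢a′  | yes refl = meet₃ a≢a′ d≢b (trans eq₁ same)
    ... | no a≢a′  | no c≢c′  = meet₂ a≢a′ c≢c′ same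
    resolve (a , b , c) (a′ , b′ , c′) s≢t eq | no ¬₃ | no ¬₂ | no _ | no _
      with _ , refl , same ← triple-injective eq | b Finₚ.≟ b′ | c Finₚ.≟ c′
    ... | yes refl | yes refl = contradiction refl s≢t
    ... | yes refl | no c≢c′  = contradiction (c′ , c≢c′ ∘ sym , sym same) ¬₃
    ... | no b≢b′  | yes refl = contradiction (b′ , b≢b′ ∘ sym , sym same) ¬₂
    ... | no b≢b′  | no c≢c′  = meet₁ b≢b′ c≢c′ same
    resolve _ _ _ () | yes _ | _     | no _  | yes _
    resolve _ _ _ () | yes _ | _     | no _  | no _
    resolve _ _ _ () | no _  | yes _ | yes _ | _
    resolve _ _ _ () | no _  | yes _ | no _  | no _
    resolve _ _ _ () | no _  | no _  | yes _ | _
    resolve _ _ _ () | no _  | no _  | no _  | yes _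

  one-point-intersection : 3 * (m * c) < m * (m * m) →
    ∃ λ v → ∃₂ λ w₁ w₂ → ∃₂ λ w₃ w₄ →
    Unique (w₁ ∷ w₂ ∷ v ∷ w₃ ∷ w₄ ∷ []) × G w₁ w₂ v ≡ G v w₃ w₄
  one-point-intersection lt =
    let s , t , s≢t , eq = collision (↔-refl ×ᶠ ↔-refl ×ᶠ ↔-refl) (↔-refl ×ᶠ ↔-refl ×ᶠ e) lt label
    in resolve s t s≢t eq

-- Copies of 3-graphs and their colourings

triangle : (x y z : Fin n) → Subset n
triangle x y z = (⁅ x ⁆ ∪ ⁅ y ⁆) ∪ ⁅ z ⁆

triangle-rotate : (x y z : Fin n) → triangle x y z ≡ triangle y z x
triangle-rotate x y z = trans (∪-assoc ⁅ x ⁆ ⁅ y ⁆ ⁅ z ⁆) (∪-comm ⁅ x ⁆ (⁅ y ⁆ ∪ ⁅ z ⁆))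

∣p∪⁅x⁆∣ : (p : Subset n) {x : Fin n} → x ∉ p → ∣ p ∪ ⁅ x ⁆ ∣ ≡ suc ∣ p ∣
∣p∪⁅x⁆∣ (inside  ∷ p) {zero}  x∉ = contradiction here x∉
∣p∪⁅x⁆∣ (outside ∷ p) {zero}  x∉ = cong (suc ∘ ∣_∣) (∪-identityʳ p)
∣p∪⁅x⁆∣ (inside  ∷ p) {suc x} x∉ = cong suc (∣p∪⁅x⁆∣ p (x∉ ∘ there))
∣p∪⁅x⁆∣ (outside ∷ p) {suc x} x∉ = ∣p∪⁅x⁆∣ p (x∉ ∘ there)

∣triangle∣ : {x y z : Fin n} → x ≢ y → x ≢ z → y ≢ z → ∣ triangle x y z ∣ ≡ 3
∣triangle∣ {x = x} {y} {z} x≢y x≢z y≢z =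
  trans (∣p∪⁅x⁆∣ (⁅ x ⁆ ∪ ⁅ y ⁆) z∉) (cong suc (trans (∣p∪⁅x⁆∣ ⁅ x ⁆ y∉) (cong suc (∣⁅x⁆∣≡1 x))))
  where
  y∉ : y ∉ ⁅ x ⁆
  y∉ = x≢y ∘ sym ∘ x∈⁅y⁆⇒x≡y x
  z∉ : z ∉ ⁅ x ⁆ ∪ ⁅ y ⁆
  z∉ z∈ with x∈p∪q⁻ ⁅ x ⁆ ⁅ y ⁆ z∈
  ... | inj₁ z∈x = x≢z (sym (x∈⁅y⁆⇒x≡y x z∈x))
  ... | inj₂ z∈y = y≢z (sym (x∈⁅y⁆⇒x≡y y z∈y))

nth : A → List A → ℕ → A
nth d []       _       = d
nth d (x ∷ _)  zero    = x
nth d (_ ∷ xs) (suc i) = nth d xs i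

nth-All : {P : A → Set} {d : A} {xs : List A} → All P xs → ∀ {i} → i < length xs → P (nth d xs i)
nth-All (p ∷ _)  {zero}  _        = p
nth-All (_ ∷ ps) {suc i} (s≤s lt) = nth-All ps lt

nth-injective : {d : A} {xs : List A} → Unique xs → ∀ i j → i < length xs → j < length xs →
                nth d xs i ≡ nth d xs j → i ≡ j
nth-injective (_ ∷ _)  zero    zero    _        _        _  = refl
nth-injective (x∉ ∷ _) zero    (suc j) _        (s≤s lt) eq = contradiction eq (nth-All x∉ lt)
nth-injective (x∉ ∷ _) (suc i) zero    (s≤s lt) _        eq = contradiction (sym eq) (nth-All x∉ lt)
nth-injective (_ ∷ u)  (suc i) (suc j) (s≤s l₁) (s≤s l₂) eq = cong suc (nth-injective u i j l₁ l₂ eq)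

Proper : ℕ → ℕ × ℕ × ℕ → Set
Proper m (a , b , c) = (a < m × b < m × c < m) × (a ≢ b × a ≢ c × b ≢ c)

proper? : ∀ m t → Dec (Proper m t)
proper? m (a , b , c) = ((a ℕₚ.<? m) ×-dec (b ℕₚ.<? m) ×-dec (c ℕₚ.<? m))
                  ×-dec (¬? (a ℕₚ.≟ b) ×-dec ¬? (a ℕₚ.≟ c) ×-dec ¬? (b ℕₚ.≟ c))

∣image∣ : ∀ H {φ : ℕ → Fin n} → IsCopy H φ → m ≤ nV H → ∀ t → Proper m t → ∣ image φ t ∣ ≡ 3
∣image∣ H copy m≤ (a , b , c) ((a< , b< , c<) , (a≢b , a≢c , b≢c)) = ∣triangle∣
  (a≢b ∘ copy a b (≤-trans a< m≤) (≤-trans b< m≤))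
  (a≢c ∘ copy a c (≤-trans a< m≤) (≤-trans c< m≤))
  (b≢c ∘ copy b c (≤-trans b< m≤) (≤-trans c< m≤))

module Colouring {n k : ℕ} (f : Fin n → Edge n → Fin k) (v₀ : Fin n) (c₀ : Fin k) where

  Local : Hyp3 → Set
  Local H = ∀ φ → IsCopy H φ → ∃[ i ] (i < nV H × Rainbow H (f (φ i)) φ)

  -- c₀ is a junk value: the colour of sets that are not edges.
  col : Fin n → Subset n → Fin k
  col u s with ∣ s ∣ ℕₚ.≟ 3
  ... | yes p = f u (s , p)
  ... | no  _ = c₀

  -- The proof of size inside an `Edge` is irrelevant, so a colour depends on the vertex set only.
  col-edge : ∀ u s (p : ∣ s ∣ ≡ 3) → f u (s , p) ≡ col u s
  col-edge u s p with ∣ s ∣ ℕₚ.≟ 3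
  ... | yes p′ = cong (λ r → f u (s , r)) (ℕₚ.≡-irrelevant p p′)
  ... | no  ¬p = contradiction p ¬p

  -- r and m bound edge and vertex indices; they stay numerals for SP1 t and SP2 t with t variable,
  -- so that the side conditions are decided by evaluation.
  record Clash (H : Hyp3) (r m : ℕ) (φ : ℕ → Fin n) (u : Fin n) : Set where
    constructor clash
    field
      j l : ℕ
      {j<r} : True (j ℕₚ.<? r)
      {l<r} : True (l ℕₚ.<? r)
      {j≢l} : False (j ℕₚ.≟ l)
      {properⱼ} : True (proper? m (edge H j))
      {properₗ} : True (proper? m (edge H l))
      same : col u (image φ (edge H j)) ≡ col u (image φ (edge H l))

  -- The vertex that `local` declares rainbow is among `xs` and so has a clash. The list may be
  -- longer than the copy: entries past `nV H` are never reached.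
  no-clashing-copy : ∀ H r m → r ≤ nE H → m ≤ nV H →
    Local H → ∀ xs → Unique xs → nV H ≤ length xs → ¬ All (Clash H r m (nth v₀ xs)) xs
  no-clashing-copy H r m r≤ m≤ local xs unique len clashes =
    let i , i< , rainbow = local φ copy
        clash j l {j<r} {l<r} {j≢l} {pⱼ} {pₗ} same = nth-All {d = v₀} clashes (≤-trans i< len)
        ∣j∣ = ∣image∣ H copy m≤ (edge H j) (toWitness pⱼ)
        ∣l∣ = ∣image∣ H copy m≤ (edge H l) (toWitness pₗ)
    in rainbow j l (≤-trans (toWitness j<r) r≤) (≤-trans (toWitness l<r) r≤) (toWitnessFalse j≢l)
         (_ , ∣j∣) (_ , ∣l∣) refl refl
         (trans (col-edge (φ i) _ ∣j∣) (trans same (sym (col-edge (φ i) _ ∣l∣))))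
    where
    φ : ℕ → Fin n
    φ = nth v₀ xs
    copy : IsCopy H φ
    copy i j i< j< = nth-injective unique i j (≤-trans i< len) (≤-trans j< len)

embed : A ↔ Fin m → m ≤ n → A → Fin n
embed e m≤n = (λ i → inject≤ i m≤n) ∘ Inverse.to e

embed-injective : (e : A ↔ Fin m) (m≤n : m ≤ n) → ∀ {x y} → embed e m≤n x ≡ embed e m≤n y → x ≡ y
embed-injective e m≤n eq = to-injective e (inject≤-injective m≤n m≤n _ _ eq)

module _ {n k : ℕ} (3≤n : 3 ≤ n) (f : Fin n → Edge n → Fin k) where

  base-vertex : Fin n
  base-vertex = inject≤ 0F 3≤n

  base-colour : Fin k
  base-colour = f base-vertex (triangle (inject≤ 0F 3≤n) (inject≤ 1F 3≤n) (inject≤ 2F 3≤n) ,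
    ∣triangle∣ (distinct 0F 1F (λ ())) (distinct 0F 2F (λ ())) (distinct 1F 2F (λ ())))
    where
    distinct : ∀ (i j : Fin 3) → i ≢ j → inject≤ i 3≤n ≢ inject≤ j 3≤n
    distinct i j i≢j = i≢j ∘ inject≤-injective 3≤n 3≤n i j

  colours-nonZero : NonZero k
  colours-nonZero = Finₚ.nonZeroIndex base-colour

-- Short paths: disjoint pairs and single points

module PairsAndPoints
  {n k : ℕ} (f : Fin n → Edge n → Fin k) (v₀ : Fin n) (c₀ : Fin k) {M N : ℕ}
  (ι : (Fin M × Fin 2) ⊎ Fin N → Fin n) (ι-injective : ∀ {x y} → ι x ≡ ι y → x ≡ y) where

  open Colouring f v₀ c₀

  pair : Fin M → Fin 2 → Fin n
  pair i s = ι (inj₁ (i , s))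

  point : Fin N → Fin n
  point z = ι (inj₂ z)

  T : Fin n → Fin N → Fin M → Fin k
  T u z i = col u (triangle (point z) (pair i 0F) (pair i 1F))

  T-rotate : ∀ u z i → T u z i ≡ col u (triangle (pair i 0F) (pair i 1F) (point z))
  T-rotate u z i = cong (col u) (triangle-rotate (point z) (pair i 0F) (pair i 1F))

  -- The points are chosen first, with the vertices of every pair agreeing on them, because `i` and
  -- `j` are found only afterwards, by comparing what `a` and `b` see on the pairs joined to `b`.
  sp3-clash : Local SP3 → k * k < M → k ^ ((M * 2) * M) < N → ⊥
  sp3-clash local M> N> =
    let a , b , a≢b , agree = function-collision ((↔-refl ×ᶠ ↔-refl) ×ᶠ ↔-refl) N>
          (λ z ((j , s) , i) → T (pair j s) z i)
        i , j , i≢j , eq = collision ↔-refl (↔-refl ×ᶠ ↔-refl) M>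
          (λ i → T (point a) b i , T (point b) b i)
    in finish a b a≢b i j i≢j (λ j s → agree ((j , s) , i)) (cong proj₁ eq) (cong proj₂ eq)
    where
    finish : ∀ a b → a ≢ b → ∀ i j → i ≢ j → (∀ j s → T (pair j s) a i ≡ T (pair j s) b i) →
             T (point a) b i ≡ T (point a) b j → T (point b) b i ≡ T (point b) b j → ⊥
    finish a b a≢b i j i≢j agree eqᵃ eqᵇ =
      no-clashing-copy SP3 3 6 ℕₚ.≤-refl ℕₚ.≤-refl local (map ι xs) (Uniqueₚ.map⁺ ι-injective unique)
        ℕₚ.≤-refl
        ( clash 1 2 (trans (sym (T-rotate (point a) b i)) eqᵃ)
        ∷ clash 0 1 (at-pair i 0F)
        ∷ clash 0 1 (at-pair i 1F)
        ∷ clash 1 2 (trans (sym (T-rotate (point b) b i)) eqᵇ)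
        ∷ clash 0 1 (at-pair j 0F)
        ∷ clash 0 1 (at-pair j 1F) ∷ [])
      where
      xs : List ((Fin M × Fin 2) ⊎ Fin N)
      xs = inj₂ a ∷ inj₁ (i , 0F) ∷ inj₁ (i , 1F) ∷ inj₂ b ∷ inj₁ (j , 0F) ∷ inj₁ (j , 1F) ∷ []
      unique : Unique xs
      unique = ((λ ()) ∷ (λ ()) ∷ (λ { refl → a≢b refl }) ∷ (λ ()) ∷ (λ ()) ∷ [])
             ∷ ((λ ()) ∷ (λ ()) ∷ (λ { refl → i≢j refl }) ∷ (λ ()) ∷ [])
             ∷ ((λ ()) ∷ (λ ()) ∷ (λ { refl → i≢j refl }) ∷ [])
             ∷ ((λ ()) ∷ (λ ()) ∷ [])
             ∷ ((λ ()) ∷ []) ∷ [] ∷ []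
      at-pair : ∀ j s → T (pair j s) a i ≡ _
      at-pair j s = trans (agree j s) (T-rotate (pair j s) b i)

  -- Rows are pairs, columns are points. Along the path a p b q c, `κ` serves p on edges 0, 1 and q
  -- on edges 2, 3, while `ρ` serves the three points on edges 1, 2, which both contain `b`.
  sp2-clash : Local (SP2 4) →
    M * ((k * k) * 2) + N * (N * (N * (k * (k * k)))) < M * N → ⊥
  sp2-clash local lt =
    let p , q , p≢q , a , b , c , distinct , (κpa , _) , (_ , κqb) , same = shared-triple lt
    in finish p q p≢q a b c distinct κpa κqb same
    where
    κ : Fin M → Fin N → Fin k × Fin k
    κ p z = T (pair p 0F) z p , T (pair p 1F) z p
    ρ : Fin N → Fin N → Fin N → Fin M → Fin k × Fin k × Fin k
    ρ a b c p = T (point a) b p , T (point b) b p , T (point c) b p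
    open SharedTriple (↔-refl ×ᶠ ↔-refl) (↔-refl ×ᶠ ↔-refl ×ᶠ ↔-refl) κ ρ

    finish : ∀ p q → p ≢ q → ∀ a b c → a ≢ b × a ≢ c × b ≢ c → κ p a ≡ κ p b → κ q b ≡ κ q c →
             ρ a b c p ≡ ρ a b c q → ⊥
    finish p q p≢q a b c (a≢b , a≢c , b≢c) κp κq same =
      no-clashing-copy (SP2 4) 4 7 ℕₚ.≤-refl ℕₚ.≤-refl local (map ι xs) (Uniqueₚ.map⁺ ι-injective unique)
        ℕₚ.≤-refl
        ( clash 1 2 (at-point a (cong proj₁ same))
        ∷ clash 0 1 (trans (cong proj₁ κp) (T-rotate _ b p))
        ∷ clash 0 1 (trans (cong proj₂ κp) (T-rotate _ b p))
        ∷ clash 1 2 (at-point b (cong (proj₁ ∘ proj₂) same))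
        ∷ clash 2 3 (trans (cong proj₁ κq) (T-rotate _ c q))
        ∷ clash 2 3 (trans (cong proj₂ κq) (T-rotate _ c q))
        ∷ clash 1 2 (at-point c (cong (proj₂ ∘ proj₂) same)) ∷ [])
      where
      xs : List ((Fin M × Fin 2) ⊎ Fin N)
      xs = inj₂ a ∷ inj₁ (p , 0F) ∷ inj₁ (p , 1F) ∷ inj₂ b ∷ inj₁ (q , 0F) ∷ inj₁ (q , 1F) ∷ inj₂ c ∷ []
      unique : Unique xs
      unique = ((λ ()) ∷ (λ ()) ∷ (λ { refl → a≢b refl }) ∷ (λ ()) ∷ (λ ()) ∷ (λ { refl → a≢c refl }) ∷ [])
             ∷ ((λ ()) ∷ (λ ()) ∷ (λ { refl → p≢q refl }) ∷ (λ ()) ∷ (λ ()) ∷ [])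
             ∷ ((λ ()) ∷ (λ ()) ∷ (λ { refl → p≢q refl }) ∷ (λ ()) ∷ [])
             ∷ ((λ ()) ∷ (λ ()) ∷ (λ { refl → b≢c refl }) ∷ [])
             ∷ ((λ ()) ∷ (λ ()) ∷ [])
             ∷ ((λ ()) ∷ []) ∷ [] ∷ []
      at-point : ∀ z → T (point z) b p ≡ T (point z) b q → _ ≡ _
      at-point z = trans (sym (T-rotate (point z) b p))

  -- Rows are points, columns are pairs. `κ` serves x on edges 0, 1 and y on edges 2, 3, while `ρ`
  -- records six colours, one for each vertex of the three pairs, to serve them on edges 1, 2
  -- through the pair `b`.
  sp1-clash : Local (SP1 4) →
    N * (k * 2) + M * (M * (M * ((k * k) * ((k * k) * (k * k))))) < N * M → ⊥
  sp1-clash local lt =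
    let x , y , x≢y , a , b , c , distinct , (κxa , _) , (_ , κyb) , same = shared-triple lt
    in finish x y x≢y a b c distinct κxa κyb same
    where
    κ : Fin N → Fin M → Fin k
    κ x p = T (point x) x p
    by-pair : Fin M → Fin N → Fin M → Fin k × Fin k
    by-pair a x p = T (pair a 0F) x p , T (pair a 1F) x p
    ρ : Fin M → Fin M → Fin M → Fin N → (Fin k × Fin k) × (Fin k × Fin k) × (Fin k × Fin k)
    ρ a b c x = by-pair a x b , by-pair b x b , by-pair c x b
    open SharedTriple ↔-refl
      ((↔-refl ×ᶠ ↔-refl) ×ᶠ (↔-refl ×ᶠ ↔-refl) ×ᶠ (↔-refl ×ᶠ ↔-refl)) κ ρ

    finish : ∀ x y → x ≢ y → ∀ a b c → a ≢ b × a ≢ c × b ≢ c → κ x a ≡ κ x b → κ y b ≡ κ y c →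
             ρ a b c x ≡ ρ a b c y → ⊥
    finish x y x≢y a b c (a≢b , a≢c , b≢c) κx κy same =
      no-clashing-copy (SP1 4) 4 8 ℕₚ.≤-refl ℕₚ.≤-refl local (map ι xs) (Uniqueₚ.map⁺ ι-injective unique)
        ℕₚ.≤-refl
        ( clash 1 2 (at-pair a 0F (cong (proj₁ ∘ proj₁) same))
        ∷ clash 1 2 (at-pair a 1F (cong (proj₂ ∘ proj₁) same))
        ∷ clash 0 1 (trans (sym (T-rotate _ x a)) κx)
        ∷ clash 1 2 (at-pair b 0F (cong (proj₁ ∘ proj₁ ∘ proj₂) same))
        ∷ clash 1 2 (at-pair b 1F (cong (proj₂ ∘ proj₁ ∘ proj₂) same))
        ∷ clash 2 3 (trans (sym (T-rotate _ y b)) κy)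
        ∷ clash 1 2 (at-pair c 0F (cong (proj₁ ∘ proj₂ ∘ proj₂) same))
        ∷ clash 1 2 (at-pair c 1F (cong (proj₂ ∘ proj₂ ∘ proj₂) same)) ∷ [])
      where
      xs : List ((Fin M × Fin 2) ⊎ Fin N)
      xs = inj₁ (a , 0F) ∷ inj₁ (a , 1F) ∷ inj₂ x ∷ inj₁ (b , 0F) ∷ inj₁ (b , 1F) ∷ inj₂ y
         ∷ inj₁ (c , 0F) ∷ inj₁ (c , 1F) ∷ []
      unique : Unique xs
      unique = ((λ ()) ∷ (λ ()) ∷ (λ { refl → a≢b refl }) ∷ (λ ()) ∷ (λ ()) ∷ (λ { refl → a≢c refl }) ∷ (λ ()) ∷ [])
             ∷ ((λ ()) ∷ (λ ()) ∷ (λ { refl → a≢b refl }) ∷ (λ ()) ∷ (λ ()) ∷ (λ { refl → a≢c refl }) ∷ [])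
             ∷ ((λ ()) ∷ (λ ()) ∷ (λ { refl → x≢y refl }) ∷ (λ ()) ∷ (λ ()) ∷ [])
             ∷ ((λ ()) ∷ (λ ()) ∷ (λ { refl → b≢c refl }) ∷ (λ ()) ∷ [])
             ∷ ((λ ()) ∷ (λ ()) ∷ (λ { refl → b≢c refl }) ∷ [])
             ∷ ((λ ()) ∷ (λ ()) ∷ [])
             ∷ ((λ ()) ∷ []) ∷ [] ∷ []
      at-pair : ∀ d s → T (pair d s) x b ≡ T (pair d s) y b → _ ≡ _
      at-pair d s eq = trans eq (T-rotate (pair d s) y b)

-- Paths with five or more edges

unique-⊎ : {xs : List A} {ys : List B} → Unique xs → Unique ys →
           Unique (map inj₁ xs ++ map inj₂ ys)
unique-⊎ {xs = xs} {ys} uxs uys = AllPairsₚ.++⁺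
  (Uniqueₚ.map⁺ inj₁-injective uxs) (Uniqueₚ.map⁺ inj₂-injective uys)
  (Allₚ.map⁺ (All.universal (λ _ → Allₚ.map⁺ (All.universal (λ _ ()) ys)) xs))

-- `Fin 2` is the pair common to the edges of the first block, `Fin (2 * k)` the candidates for its
-- two other vertices, `Fin N` the vertices voting on them. Of those that agree, `3 * m` go to the
-- search for the second block and `τ` to the tail.
module LongPath
  {n k : ℕ} .{{_ : NonZero k}} (f : Fin n → Edge n → Fin k) (v₀ : Fin n) (c₀ : Fin k)
  (τ m N : ℕ) (3mk⁴<m³ : 3 * (m * (k * (k * (k * k)))) < m * (m * m))
  (4ks<N : 4 * k * (3 * m + τ) < N)
  (ι : (Fin 2 ⊎ Fin (2 * k)) ⊎ Fin N → Fin n) (ι-injective : ∀ {x y} → ι x ≡ ι y → x ≡ y) where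

  open Colouring f v₀ c₀

  -- z y₁ y₂ z′ spans two edges meeting in {y₁, y₂} on which every vertex outside them agrees,
  -- w₁ w₂ v w₃ w₄ two edges meeting in v on which z, y₁, y₂ and z′ agree.
  record Configuration : Set where
    field
      w₁ w₂ v w₃ w₄ z y₁ y₂ z′ : Fin n
      tail : List (Fin n)
      length-tail : length tail ≡ τ
      unique : Unique ((w₁ ∷ w₂ ∷ v ∷ w₃ ∷ w₄ ∷ []) ++ (z ∷ y₁ ∷ y₂ ∷ z′ ∷ []) ++ tail)
      agree-outer : All (λ u → col u (triangle w₁ w₂ v) ≡ col u (triangle v w₃ w₄))
                        (z ∷ y₁ ∷ y₂ ∷ z′ ∷ [])
      agree-inner : All (λ u → col u (triangle z y₁ y₂) ≡ col u (triangle y₁ y₂ z′))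
                        (w₁ ∷ w₂ ∷ v ∷ w₃ ∷ w₄ ∷ tail)

  x y : Fin n
  x = ι (inj₁ (inj₁ 0F))
  y = ι (inj₁ (inj₁ 1F))

  ζ : Fin (2 * k) → Fin n
  ζ i = ι (inj₁ (inj₂ i))

  module Build (i j : Fin (2 * k)) (i≢j : i ≢ j) (us : List (Fin N)) (unique-us : Unique us)
    (long : 3 * m + τ < length us)
    (good : All (λ u → col (ι (inj₂ u)) (triangle (ζ i) x y)
                     ≡ col (ι (inj₂ u)) (triangle (ζ j) x y)) us) where

    W : Set
    W = Fin 3 × Fin m

    pick : W ⊎ Fin τ → Fin N
    pick = lookup us ∘ embed ((↔-refl ×ᶠ ↔-refl) ⊎ᶠ ↔-refl) (ℕₚ.<⇒≤ long)

    pick-injective : ∀ s t → ι (inj₂ (pick s)) ≡ ι (inj₂ (pick t)) → s ≡ t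
    pick-injective s t eq = embed-injective ((↔-refl ×ᶠ ↔-refl) ⊎ᶠ ↔-refl) (ℕₚ.<⇒≤ long)
                          (lookup-injective unique-us _ _ (inj₂-injective (ι-injective eq)))

    -- One injection out of a disjoint union, in the order of the field `unique`, so that
    -- distinctness across blocks follows from distinct constructors.
    θ : W ⊎ ((Fin 2 ⊎ Fin (2 * k)) ⊎ Fin τ) → Fin n
    θ (inj₁ w)        = ι (inj₂ (pick (inj₁ w)))
    θ (inj₂ (inj₁ z)) = ι (inj₁ z)
    θ (inj₂ (inj₂ t)) = ι (inj₂ (pick (inj₂ t)))

    θ-injective : ∀ {s t} → θ s ≡ θ t → s ≡ t
    θ-injective {inj₁ w}        {inj₁ w′}        eq = cong inj₁ (inj₁-injective (pick-injective (inj₁ w) (inj₁ w′) eq))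
    θ-injective {inj₁ _}        {inj₂ (inj₁ _)}  eq = contradiction (ι-injective eq) λ ()
    θ-injective {inj₁ w}        {inj₂ (inj₂ t)}  eq = contradiction (pick-injective (inj₁ w) (inj₂ t) eq) λ ()
    θ-injective {inj₂ (inj₁ _)} {inj₁ _}         eq = contradiction (ι-injective eq) λ ()
    θ-injective {inj₂ (inj₁ _)} {inj₂ (inj₁ _)}  eq = cong (inj₂ ∘ inj₁) (inj₁-injective (ι-injective eq))
    θ-injective {inj₂ (inj₁ _)} {inj₂ (inj₂ _)}  eq = contradiction (ι-injective eq) λ ()
    θ-injective {inj₂ (inj₂ t)} {inj₁ w}         eq = contradiction (pick-injective (inj₂ t) (inj₁ w) eq) λ ()
    θ-injective {inj₂ (inj₂ _)} {inj₂ (inj₁ _)}  eq = contradiction (ι-injective eq) λ ()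
    θ-injective {inj₂ (inj₂ t)} {inj₂ (inj₂ t′)} eq =
      cong (inj₂ ∘ inj₂) (inj₂-injective (pick-injective (inj₂ t) (inj₂ t′) eq))

    ω : W → Fin n
    ω = θ ∘ inj₁

    good-pick : ∀ s → col (ι (inj₂ (pick s))) (triangle (ζ i) x y)
                    ≡ col (ι (inj₂ (pick s))) (triangle x y (ζ j))
    good-pick s = trans (All.lookup good (∈-lookup _))
                        (cong (col (ι (inj₂ (pick s)))) (triangle-rotate (ζ j) x y))

    G : (a b c : W) → Fin k × Fin k × Fin k × Fin k
    G a b c = by (ζ i) , by x , by y , by (ζ j)
      where
      by : Fin n → Fin k
      by u = col u (triangle (ω a) (ω b) (ω c))

    G-rotate : ∀ a b c → G a b c ≡ G b c a
    G-rotate a b c = cong (λ t → col (ζ i) t , col x t , col y t , col (ζ j) t)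
                          (triangle-rotate (ω a) (ω b) (ω c))

    zs : List (Fin 2 ⊎ Fin (2 * k))
    zs = inj₂ i ∷ inj₁ 0F ∷ inj₁ 1F ∷ inj₂ j ∷ []

    unique-zs : Unique zs
    unique-zs = ((λ ()) ∷ (λ ()) ∷ (λ { refl → i≢j refl }) ∷ [])
              ∷ ((λ ()) ∷ (λ ()) ∷ []) ∷ ((λ ()) ∷ []) ∷ [] ∷ []

    tail : List (Fin n)
    tail = map θ (map inj₂ (map inj₂ (allFin τ)))

    assemble : ∀ v w₁ w₂ w₃ w₄ → Unique (w₁ ∷ w₂ ∷ v ∷ w₃ ∷ w₄ ∷ []) →
               G w₁ w₂ v ≡ G v w₃ w₄ → Configuration
    assemble v w₁ w₂ w₃ w₄ unique-ws same = record
      { w₁ = ω w₁ ; w₂ = ω w₂ ; v = ω v ; w₃ = ω w₃ ; w₄ = ω w₄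
      ; z = ζ i ; y₁ = x ; y₂ = y ; z′ = ζ j ; tail = tail
      ; length-tail = trans (length-map θ (map inj₂ (map inj₂ (allFin τ))))
          (trans (length-map inj₂ (map inj₂ (allFin τ)))
          (trans (length-map inj₂ (allFin τ)) (length-tabulate id)))
      ; unique = Uniqueₚ.map⁺ θ-injective
          (unique-⊎ unique-ws (unique-⊎ unique-zs (Uniqueₚ.allFin⁺ τ)))
      ; agree-outer = cong proj₁ same ∷ cong (proj₁ ∘ proj₂) same
          ∷ cong (proj₁ ∘ proj₂ ∘ proj₂) same ∷ cong (proj₂ ∘ proj₂ ∘ proj₂) same ∷ []
      ; agree-inner = good-pick (inj₁ w₁) ∷ good-pick (inj₁ w₂) ∷ good-pick (inj₁ v)
          ∷ good-pick (inj₁ w₃) ∷ good-pick (inj₁ w₄)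
          ∷ Allₚ.map⁺ (Allₚ.map⁺ (Allₚ.map⁺ (All.universal (good-pick ∘ inj₂) (allFin τ))))
      }

    configuration : Configuration
    configuration =
      let v , w₁ , w₂ , w₃ , w₄ , unique-ws , same =
            one-point-intersection (↔-refl ×ᶠ ↔-refl ×ᶠ ↔-refl ×ᶠ ↔-refl) G G-rotate 3mk⁴<m³
      in assemble v w₁ w₂ w₃ w₄ unique-ws same

  configuration : Configuration
  configuration =
    let i , j , i≢j , us , unique-us , long , good =
          popular-pair (λ u i → col (ι (inj₂ u)) (triangle (ζ i) x y)) (3 * m + τ) 4ks<N
    in Build.configuration i j i≢j us unique-us long good

  -- The blocks are edges 0, 1 and edges 3, 4, joined by edge 2. `SP1` starts with two edges meeting
  -- in a point and `SP2` with two meeting in a pair, hence two orders.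
  vertices₁ vertices₂ : Configuration → List (Fin n)
  vertices₁ C = (w₁ ∷ w₂ ∷ v ∷ w₃ ∷ w₄ ∷ []) ++ (z ∷ y₁ ∷ y₂ ∷ z′ ∷ []) ++ tail
    where open Configuration C
  vertices₂ C = (z ∷ y₁ ∷ y₂ ∷ z′ ∷ []) ++ (w₁ ∷ w₂ ∷ v ∷ w₃ ∷ w₄ ∷ []) ++ tail
    where open Configuration C

  sp1-clash : ∀ {t} → 5 ≤ t → 9 ≤ nV (SP1 t) → nV (SP1 t) ≤ 9 + τ → ¬ Local (SP1 t)
  sp1-clash {t} 5≤t 9≤nV nV≤ local = no-clashing-copy (SP1 t) 5 9 5≤t 9≤nV local (vertices₁ configuration)
      (Configuration.unique configuration)
      (subst (λ l → nV (SP1 t) ≤ 9 + l) (sym (Configuration.length-tail configuration)) nV≤)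
      (clashes configuration)
    where
    clashes : ∀ C → All (Clash (SP1 t) 5 9 (nth v₀ (vertices₁ C))) (vertices₁ C)
    clashes C = Allₚ.++⁺ (Allₚ.++⁻ˡ ws inner) (Allₚ.++⁺ outer (Allₚ.++⁻ʳ ws inner))
      where
      open Configuration C
      ws = w₁ ∷ w₂ ∷ v ∷ w₃ ∷ w₄ ∷ []
      inner : All (Clash (SP1 t) 5 9 (nth v₀ (vertices₁ C))) (ws ++ tail)
      inner = All.map (λ eq → clash 3 4 eq) agree-inner
      outer : All (Clash (SP1 t) 5 9 (nth v₀ (vertices₁ C))) (z ∷ y₁ ∷ y₂ ∷ z′ ∷ [])
      outer = All.map (λ eq → clash 0 1 eq) agree-outer

  sp2-clash : ∀ {t} → 5 ≤ t → 9 ≤ nV (SP2 t) → nV (SP2 t) ≤ 9 + τ → ¬ Local (SP2 t)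
  sp2-clash {t} 5≤t 9≤nV nV≤ local = no-clashing-copy (SP2 t) 5 9 5≤t 9≤nV local (vertices₂ configuration)
      (unique₂ configuration)
      (subst (λ l → nV (SP2 t) ≤ 9 + l) (sym (Configuration.length-tail configuration)) nV≤)
      (clashes configuration)
    where
    unique₂ : ∀ C → Unique (vertices₂ C)
    unique₂ C = Unique-resp-↭ (setoid _) (↭⇒↭ₛ (shifts (w₁ ∷ w₂ ∷ v ∷ w₃ ∷ w₄ ∷ []) (z ∷ y₁ ∷ y₂ ∷ z′ ∷ []))) unique
      where open Configuration C
    clashes : ∀ C → All (Clash (SP2 t) 5 9 (nth v₀ (vertices₂ C))) (vertices₂ C)
    clashes C = Allₚ.++⁺ outer inner
      where
      open Configuration C
      inner : All (Clash (SP2 t) 5 9 (nth v₀ (vertices₂ C))) (w₁ ∷ w₂ ∷ v ∷ w₃ ∷ w₄ ∷ tail)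
      inner = All.map (λ eq → clash 0 1 eq) agree-inner
      outer : All (Clash (SP2 t) 5 9 (nth v₀ (vertices₂ C))) (z ∷ y₁ ∷ y₂ ∷ z′ ∷ [])
      outer = All.map (λ eq → clash 3 4 eq) agree-outer

-- Asymptotics

power-≤ : ∀ k .{{_ : NonZero k}} c {a b} → a ≤ b → c * k ^ a ≤ c * k ^ b
power-≤ k c a≤b = ℕₚ.*-monoʳ-≤ c (ℕₚ.^-monoʳ-≤ k a≤b)

n≤2^n : ∀ n → n ≤ 2 ^ n
n≤2^n zero    = z≤n
n≤2^n (suc n) = begin
  1 + n               ≤⟨ ℕₚ.+-mono-≤ (ℕₚ.m^n>0 2 n) (n≤2^n n) ⟩
  2 ^ n + 2 ^ n       ≡⟨ cong (2 ^ n +_) (ℕₚ.+-identityʳ (2 ^ n)) ⟨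
  2 ^ suc n           ∎
  where open ≤-Reasoning

-- Taking `4 * c₁` columns makes the first term half of the number of cells. The other half must
-- exceed 64 c₁³ c₂; this sets the number of rows, and the `suc` leaves `2 * c₁` to spare.
shared-triple-room : ∀ c₁ c₂ .{{_ : NonZero c₁}} →
  suc (32 * (c₁ * c₁ * c₂)) * (c₁ * 2) + 4 * c₁ * (4 * c₁ * (4 * c₁ * c₂))
  < suc (32 * (c₁ * c₁ * c₂)) * (4 * c₁)
shared-triple-room c₁ c₂ =
  subst (before <_) (expand c₁ c₂) (ℕₚ.m<m+n before (>-nonZero⁻¹ (2 * c₁) {{ℕₚ.m*n≢0 2 c₁}}))
  where
  before : ℕ
  before = suc (32 * (c₁ * c₁ * c₂)) * (c₁ * 2) + 4 * c₁ * (4 * c₁ * (4 * c₁ * c₂))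
  expand : ∀ c₁ c₂ →
    suc (32 * (c₁ * c₁ * c₂)) * (c₁ * 2) + 4 * c₁ * (4 * c₁ * (4 * c₁ * c₂)) + 2 * c₁
    ≡ suc (32 * (c₁ * c₁ * c₂)) * (4 * c₁)
  expand = solve-∀

pairs-and-points : ∀ M N → ((Fin M × Fin 2) ⊎ Fin N) ↔ Fin (M * 2 + N)
pairs-and-points _ _ = (↔-refl ×ᶠ ↔-refl) ⊎ᶠ ↔-refl

sp3-bound : 3 ≤ n → LocalColoring n SP3 k → n ≤ 2 ^ (9 * k ^ 8)
sp3-bound {n} {k} 3≤n (f , local) = begin
  n                               ≤⟨ ℕₚ.<⇒≤ small ⟩
  M * 2 + suc (k ^ E)             ≡⟨ ℕₚ.+-suc (M * 2) (k ^ E) ⟩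
  suc (M * 2) + k ^ E             ≤⟨ ℕₚ.+-mono-≤ first second ⟩
  2 ^ (8 * k ^ 8) + 2 ^ (8 * k ^ 8) ≡⟨ cong (2 ^ (8 * k ^ 8) +_) (ℕₚ.+-identityʳ (2 ^ (8 * k ^ 8))) ⟨
  2 ^ (1 + 8 * k ^ 8)             ≤⟨ ℕₚ.^-monoʳ-≤ 2 (ℕₚ.+-monoˡ-≤ (8 * k ^ 8) (ℕₚ.m^n>0 k 8)) ⟩
  2 ^ (9 * k ^ 8)                 ∎
  where
  open ≤-Reasoning
  instance
    k≢0 : NonZero k
    k≢0 = colours-nonZero 3≤n f
  M E : ℕ
  M = suc (k * k)
  E = (M * 2) * M
  small : n < M * 2 + suc (k ^ E)
  small = ℕₚ.≰⇒> λ size≤n →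
    let e = pairs-and-points M (suc (k ^ E))
    in PairsAndPoints.sp3-clash f (base-vertex 3≤n f) (base-colour 3≤n f)
         (embed e size≤n) (embed-injective e size≤n) local ℕₚ.≤-refl ℕₚ.≤-refl
  M≤ : M ≤ 2 * (k * k)
  M≤ = begin
    1 + k * k       ≤⟨ ℕₚ.+-monoˡ-≤ (k * k) (ℕₚ.*-mono-≤ 0<k 0<k) ⟩
    k * k + k * k   ≡⟨ cong (k * k +_) (ℕₚ.+-identityʳ (k * k)) ⟨
    2 * (k * k)     ∎
    where
    0<k : 0 < k
    0<k = >-nonZero⁻¹ k
  first : suc (M * 2) ≤ 2 ^ (8 * k ^ 8)
  first = begin
    1 + M * 2                  ≤⟨ ℕₚ.+-mono-≤ (ℕₚ.m^n>0 k 8) (ℕₚ.*-monoˡ-≤ 2 M≤) ⟩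
    k ^ 8 + 2 * (k * k) * 2    ≡⟨ cong (k ^ 8 +_) (square k) ⟩
    k ^ 8 + 4 * k ^ 2          ≤⟨ ℕₚ.+-monoʳ-≤ (k ^ 8) (power-≤ k 4 (ℕₚ.m≤m+n 2 6)) ⟩
    5 * k ^ 8                  ≤⟨ ℕₚ.*-monoˡ-≤ (k ^ 8) (ℕₚ.m≤m+n 5 3) ⟩
    8 * k ^ 8                  ≤⟨ n≤2^n (8 * k ^ 8) ⟩
    2 ^ (8 * k ^ 8)            ∎
    where
    square : ∀ k → 2 * (k * k) * 2 ≡ 4 * (k * (k * 1))
    square = solve-∀
  second : k ^ E ≤ 2 ^ (8 * k ^ 8)
  second = begin
    k ^ E          ≤⟨ ℕₚ.^-monoˡ-≤ E (n≤2^n k) ⟩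
    (2 ^ k) ^ E    ≡⟨ ℕₚ.^-*-assoc 2 k E ⟩
    2 ^ (k * E)    ≤⟨ ℕₚ.^-monoʳ-≤ 2 (begin
      k * E                                     ≤⟨ ℕₚ.*-monoʳ-≤ k (ℕₚ.*-mono-≤ (ℕₚ.*-monoˡ-≤ 2 M≤) M≤) ⟩
      k * ((2 * (k * k) * 2) * (2 * (k * k)))   ≡⟨ fifth k ⟩
      -- The counting gives exponent 5, here relaxed to the 8 of the statement.
      8 * k ^ 5                                 ≤⟨ power-≤ k 8 (ℕₚ.m≤m+n 5 3) ⟩
      8 * k ^ 8                                 ∎) ⟩
    2 ^ (8 * k ^ 8) ∎
    where
    fifth : ∀ k → k * ((2 * (k * k) * 2) * (2 * (k * k))) ≡ 8 * (k * (k * (k * (k * (k * 1)))))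
    fifth = solve-∀

sp3-omega : OmegaLogLog8 SP3
-- `⌊log₂ ⌊log₂ 4 ⌋ ⌋` evaluates to 1, so from the threshold 4 on the iterated logarithm is a factor
-- of at least 1.
sp3-omega = 9 , 4 , λ n 4≤n k lc → begin
  ⌊log₂ n ⌋                              ≤⟨ ⌊log₂⌋-mono-≤ (sp3-bound (≤-trans (ℕₚ.n≤1+n 3) 4≤n) lc) ⟩
  ⌊log₂ (2 ^ (9 * k ^ 8)) ⌋              ≡⟨ ⌊log₂[2^n]⌋≡n (9 * k ^ 8) ⟩
  9 * k ^ 8                              ≡⟨ ℕₚ.*-identityʳ (9 * k ^ 8) ⟨
  9 * k ^ 8 * ⌊log₂ ⌊log₂ 4 ⌋ ⌋          ≤⟨ ℕₚ.*-monoʳ-≤ (9 * k ^ 8) (⌊log₂⌋-mono-≤ (⌊log₂⌋-mono-≤ 4≤n)) ⟩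
  9 * k ^ 8 * ⌊log₂ ⌊log₂ n ⌋ ⌋          ∎
  where open ≤-Reasoning

sp2-omega-4 : OmegaRoot (SP2 4) 7
-- With k² for `c₁` and k³ for `c₂`, the 32k⁷ + 1 pairs use 64k⁷ + 2 vertices and the points 4k²; 70
-- = 64 + 2 + 4.
sp2-omega-4 = 70 , 3 , λ n 3≤n k (f , local) →
  let instance _ = colours-nonZero 3≤n f in
  ℕₚ.≮⇒≥ λ lt →
    let size≤n = ≤-trans (size≤ k) (ℕₚ.<⇒≤ lt)
        e = pairs-and-points (suc (32 * (k * k * (k * k) * (k * (k * k))))) (4 * (k * k))
    in PairsAndPoints.sp2-clash f (base-vertex 3≤n f) (base-colour 3≤n f)
         (embed e size≤n) (embed-injective e size≤n) local
         (shared-triple-room (k * k) (k * (k * k)) {{ℕₚ.m*n≢0 k k}})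
  where
  open ≤-Reasoning
  expand : ∀ k → suc (32 * (k * k * (k * k) * (k * (k * k)))) * 2 + 4 * (k * k)
               ≡ 2 * 1 + 64 * (k * (k * (k * (k * (k * (k * (k * 1))))))) + 4 * (k * (k * 1))
  expand = solve-∀
  collect : ∀ x → 2 * x + 64 * x + 4 * x ≡ 70 * x
  collect = solve-∀
  size≤ : ∀ k .{{_ : NonZero k}} →
          suc (32 * (k * k * (k * k) * (k * (k * k)))) * 2 + 4 * (k * k) ≤ 70 * k ^ 7
  size≤ k = begin
    suc (32 * (k * k * (k * k) * (k * (k * k)))) * 2 + 4 * (k * k) ≡⟨ expand k ⟩
    2 * k ^ 0 + 64 * k ^ 7 + 4 * k ^ 2
      ≤⟨ ℕₚ.+-mono-≤ (ℕₚ.+-monoˡ-≤ (64 * k ^ 7) (power-≤ k 2 {0} {7} z≤n)) (power-≤ k 4 (ℕₚ.m≤m+n 2 5)) ⟩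
    2 * k ^ 7 + 64 * k ^ 7 + 4 * k ^ 7 ≡⟨ collect (k ^ 7) ⟩
    70 * k ^ 7 ∎

sp1-omega-4 : OmegaRoot (SP1 4) 8
-- With k for `c₁` and k⁶ for `c₂`: 32k⁸ + 1 points and 4k pairs; 41 = 32 + 1 + 8.
sp1-omega-4 = 41 , 3 , λ n 3≤n k (f , local) →
  let instance _ = colours-nonZero 3≤n f in
  ℕₚ.≮⇒≥ λ lt →
    let size≤n = ≤-trans (size≤ k) (ℕₚ.<⇒≤ lt)
        e = pairs-and-points (4 * k) (suc (32 * (k * k * (k * k * (k * k * (k * k))))))
    in PairsAndPoints.sp1-clash f (base-vertex 3≤n f) (base-colour 3≤n f)
         (embed e size≤n) (embed-injective e size≤n) local
         (shared-triple-room k (k * k * (k * k * (k * k))))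
  where
  open ≤-Reasoning
  expand : ∀ k → 4 * k * 2 + suc (32 * (k * k * (k * k * (k * k * (k * k)))))
               ≡ 8 * (k * 1) + 1 * 1 + 32 * (k * (k * (k * (k * (k * (k * (k * (k * 1))))))))
  expand = solve-∀
  collect : ∀ x → 8 * x + 1 * x + 32 * x ≡ 41 * x
  collect = solve-∀
  size≤ : ∀ k .{{_ : NonZero k}} →
          4 * k * 2 + suc (32 * (k * k * (k * k * (k * k * (k * k))))) ≤ 41 * k ^ 8
  size≤ k = begin
    4 * k * 2 + suc (32 * (k * k * (k * k * (k * k * (k * k))))) ≡⟨ expand k ⟩
    8 * k ^ 1 + 1 * k ^ 0 + 32 * k ^ 8
      ≤⟨ ℕₚ.+-monoˡ-≤ (32 * k ^ 8) (ℕₚ.+-mono-≤ (power-≤ k 8 (ℕₚ.m≤m+n 1 7)) (power-≤ k 1 {0} {8} z≤n)) ⟩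
    8 * k ^ 8 + 1 * k ^ 8 + 32 * k ^ 8 ≡⟨ collect (k ^ 8) ⟩
    41 * k ^ 8 ∎

module LongPathOmega (τ : ℕ) where

  part others : ℕ → ℕ
  -- The search for the second block asks for 3k⁴ < m², and here m² = 4k⁴.
  part k = 2 * (k * k)
  others k = suc (4 * k * (3 * part k + τ))

  size≤ : ∀ k .{{_ : NonZero k}} → (2 + 2 * k) + others k ≤ (29 + 4 * τ) * k ^ 3
  size≤ k = begin
    (2 + 2 * k) + others k ≡⟨ expand k τ ⟩
    3 * k ^ 0 + (2 + 4 * τ) * k ^ 1 + 24 * k ^ 3
      ≤⟨ ℕₚ.+-monoˡ-≤ (24 * k ^ 3) (ℕₚ.+-mono-≤ (power-≤ k 3 {0} {3} z≤n) (power-≤ k (2 + 4 * τ) (ℕₚ.m≤m+n 1 2))) ⟩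
    3 * k ^ 3 + (2 + 4 * τ) * k ^ 3 + 24 * k ^ 3 ≡⟨ collect τ (k ^ 3) ⟩
    (29 + 4 * τ) * k ^ 3 ∎
    where
    open ≤-Reasoning
    expand : ∀ k τ → (2 + 2 * k) + suc (4 * k * (3 * (2 * (k * k)) + τ))
                   ≡ 3 * 1 + (2 + 4 * τ) * (k * 1) + 24 * (k * (k * (k * 1)))
    expand = solve-∀
    collect : ∀ τ x → 3 * x + (2 + 4 * τ) * x + 24 * x ≡ (29 + 4 * τ) * x
    collect = solve-∀

  room : ∀ k .{{_ : NonZero k}} → 3 * (part k * (k * (k * (k * k)))) < part k * (part k * part k)
  room k = subst (3 * (part k * (k * (k * (k * k)))) <_) (expand k)
    (ℕₚ.m<m+n _ (>-nonZero⁻¹ (2 * k ^ 6) {{ℕₚ.m*n≢0 2 (k ^ 6) {{_}} {{ℕₚ.m^n≢0 k 6}}}}))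
    where
    expand : ∀ k → 3 * (2 * (k * k) * (k * (k * (k * k)))) + 2 * (k * (k * (k * (k * (k * (k * 1))))))
                 ≡ 2 * (k * k) * (2 * (k * k) * (2 * (k * k)))
    expand = solve-∀

  module _ {n k : ℕ} (3≤n : 3 ≤ n) (f : Fin n → Edge n → Fin k)
           (lt : (29 + 4 * τ) * k ^ 3 < n) where

    private instance
      k≢0 : NonZero k
      k≢0 = colours-nonZero 3≤n f

    size≤n : (2 + 2 * k) + others k ≤ n
    size≤n = ≤-trans (size≤ k) (ℕₚ.<⇒≤ lt)

    vertices : ((Fin 2 ⊎ Fin (2 * k)) ⊎ Fin (others k)) ↔ Fin ((2 + 2 * k) + others k)
    vertices = (↔-refl ⊎ᶠ ↔-refl) ⊎ᶠ ↔-refl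

    open LongPath f (base-vertex 3≤n f) (base-colour 3≤n f) τ (part k) (others k)
      (room k) ℕₚ.≤-refl (embed vertices size≤n) (embed-injective vertices size≤n) public
      using (sp1-clash; sp2-clash)

-- The tail gets as many vertices as the whole path, so the list is long enough for every `t`; the
-- constant may depend on `t`. At `t = 5` the vertex count evaluates to 9, and monotonicity covers
-- larger `t`.
sp1-omega : ∀ t → 5 ≤ t → OmegaRoot (SP1 t) 3
sp1-omega t 5≤t = 29 + 4 * nV (SP1 t) , 3 , λ n 3≤n k (f , local) → ℕₚ.≮⇒≥ λ lt →
  LongPathOmega.sp1-clash (nV (SP1 t)) 3≤n f lt 5≤t
    (/-monoˡ-≤ 2 (ℕₚ.+-monoˡ-≤ 4 (ℕₚ.*-monoʳ-≤ 3 5≤t))) (ℕₚ.m≤n+m (nV (SP1 t)) 9) local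

sp2-omega : ∀ t → 5 ≤ t → OmegaRoot (SP2 t) 3
sp2-omega t 5≤t = 29 + 4 * nV (SP2 t) , 3 , λ n 3≤n k (f , local) → ℕₚ.≮⇒≥ λ lt →
  LongPathOmega.sp2-clash (nV (SP2 t)) 3≤n f lt 5≤t
    (/-monoˡ-≤ 2 (ℕₚ.+-monoˡ-≤ 3 (ℕₚ.*-monoʳ-≤ 3 5≤t))) (ℕₚ.m≤n+m (nV (SP2 t)) 9) local

theorem1p5 : OmegaLogLog8 SP3
    × (OmegaRoot (SP1 4) 8 × OmegaRoot (SP2 4) 7)
    × (∀ (t : ℕ) → 5 ≤ t → OmegaRoot (SP1 t) 3 × OmegaRoot (SP2 t) 3)
theorem1p5 = sp3-omega , (sp1-omega-4 , sp2-omega-4) , λ t 5≤t → sp1-omega t 5≤t , sp2-omega t 5≤t
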